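{- Let $k\ge1$. For all $n\ge k$, $$N^{12\cdots k}_{13\text{ - }2}(n)=C_{n+1-k}.$$
   Context: A permutation $\pi=\pi_1\cdots\pi_n$ of $\{1,\dots,n\}$ contains the generalized pattern $13\text{ - }2$ if there are indices $i,j$ with $i+1<j\le n$ such that $\pi_i\pi_{i+1}\pi_j$ is order-isomorphic to $132$; otherwise it avoids it. A permutation $\pi$ begins with a pattern $p=p_1\cdots p_k$ if $n\ge k$ and $\pi_1\cdots\pi_k$ is order-isomorphic to $p$. $N^p_q(n)$ is the number of permutations of $\{1,\dots,n\}$ that avoid $q$ and begin with $p$. $C_m=\frac1{m+1}\binom{2m}{m}$ is the $m$th Catalan number. -}

module Defs where

open import Data.Fin.Base as Fin using (Fin; zero; suc; toℕ; inject≤; punchIn)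
import Data.Fin.Properties as Fin
open import Data.Fin.Permutation as Perm
  using (Permutation′; _⟨$⟩ʳ_; _≈_; insert; remove; insert-remove; insert-punchIn)
open import Data.List.Base using (List; [_]; allFin; cartesianProductWith; filter; length)
import Data.List.Membership.Propositional.Properties as ∈
import Data.List.Membership.Setoid.Properties as ∈ₛ
import Data.List.Relation.Unary.All as All
import Data.List.Relation.Unary.AllPairs as AllPairs
open import Data.List.Relation.Unary.Any using (here)
open import Data.List.Relation.Unary.Enumerates.Setoid using (IsEnumeration)
import Data.List.Relation.Unary.Unique.Propositional.Properties as Unique
open import Data.List.Relation.Unary.Unique.Setoid using (Unique)
import Data.List.Relation.Unary.Unique.Setoid.Properties as Uniqueₛ
open import Data.Nat.Base
open import Data.Nat.Combinatorics
open import Data.Nat.Divisibility using (_∣_; divides)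
open import Data.Nat.DivMod using (_/_; m/n*n≡m)
open import Data.Nat.Properties
open import Data.Product.Base using (Σ; ∃; _×_; _,_; proj₁; proj₂; uncurry)
open import Data.Vec.Functional using (Vector; []; _∷_)
open import Function.Base using (_∘_)
open import Function.Bundles using (_⇔_; mk⇔; Equivalence)
open import Relation.Binary.Bundles using (Setoid)
open import Relation.Binary.PropositionalEquality hiding ([_])
open import Relation.Nullary using (Dec; yes; no; ¬_)
open import Relation.Nullary.Decidable using (map′; _×-dec_; _→-dec_; ¬?)
open import Relation.Unary using (Decidable)

-- One-line notation π₁⋯πₙ. Positions are indexed by Fin n, hence from 0;
-- letters are 1, …, n.
word : ∀ {n} → Permutation′ n → Vector ℕ n
word π i = suc (toℕ (π ⟨$⟩ʳ i))

OrderIsomorphic : ∀ {k} → Vector ℕ k → Vector ℕ k → Set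
OrderIsomorphic u v = ∀ i j → u i < u j ⇔ v i < v j

orderIsomorphic? : ∀ {k} (u v : Vector ℕ k) → Dec (OrderIsomorphic u v)
orderIsomorphic? u v = Fin.all? λ i → Fin.all? λ j →
  map′ (uncurry mk⇔) (λ e → Equivalence.to e , Equivalence.from e)
    (((u i <? u j) →-dec (v i <? v j)) ×-dec ((v i <? v j) →-dec (u i <? u j)))

-- i⁺ is the position immediately after i.
Contains13-2 : ∀ {n} → Permutation′ n → Set
Contains13-2 {n} π = ∃ λ (i : Fin n) → ∃ λ (i⁺ : Fin n) → ∃ λ (j : Fin n) →
  toℕ i⁺ ≡ suc (toℕ i) × i⁺ Fin.< j ×
  OrderIsomorphic (word π i ∷ word π i⁺ ∷ word π j ∷ []) (1 ∷ 3 ∷ 2 ∷ [])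

contains13-2? : ∀ {n} → Decidable (Contains13-2 {n})
contains13-2? π = Fin.any? λ i → Fin.any? λ i⁺ → Fin.any? λ j →
  (toℕ i⁺ ≟ suc (toℕ i)) ×-dec (i⁺ Fin.<? j) ×-dec orderIsomorphic? _ _

Avoids13-2 : ∀ {n} → Permutation′ n → Set
Avoids13-2 π = ¬ Contains13-2 π

avoids13-2? : ∀ {n} → Decidable (Avoids13-2 {n})
avoids13-2? π = ¬? (contains13-2? π)

BeginsWith : ∀ {k n} → Permutation′ k → Permutation′ n → Set
BeginsWith {k} {n} p π = Σ (k ≤ n) λ k≤n →
  OrderIsomorphic (λ i → word π (inject≤ i k≤n)) (word p)

beginsWith? : ∀ {k n} (p : Permutation′ k) → Decidable (BeginsWith {k} {n} p)
beginsWith? {k} {n} p π with k ≤? n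
... | no  k≰n = no (k≰n ∘ proj₁)
... | yes k≤n = map′ (k≤n ,_) proj₂ (orderIsomorphic? _ _)

-- All permutations of {1, …, n}, each listed once: see permutations-complete
-- and permutations-unique. In the step, the new letter goes to the front.
permutations : ∀ n → List (Permutation′ n)
permutations zero    = [ Perm.id ]
permutations (suc n) = cartesianProductWith (insert zero) (allFin (suc n)) (permutations n)

permutationSetoid : ℕ → Setoid _ _
permutationSetoid n = record
  { Carrier       = Permutation′ n
  ; _≈_           = _≈_
  ; isEquivalence = record
    { refl  = λ _ → refl
    ; sym   = λ π≈ρ i → sym (π≈ρ i)
    ; trans = λ π≈ρ ρ≈σ i → trans (π≈ρ i) (ρ≈σ i)
    }
  }

insert-cong : ∀ {n} {a b : Fin (suc n)} {π ρ : Permutation′ n} →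
              a ≡ b → π ≈ ρ → insert zero a π ≈ insert zero b ρ
insert-cong refl π≈ρ zero    = refl
insert-cong refl π≈ρ (suc i) = cong (punchIn _) (π≈ρ i)

insert-injective : ∀ {n} {a b : Fin (suc n)} {π ρ : Permutation′ n} →
                   insert zero a π ≈ insert zero b ρ → a ≡ b × π ≈ ρ
insert-injective {a = a} eq with eq zero
... | refl = refl , λ i → Fin.punchIn-injective a _ _ (eq (suc i))

permutations-complete : ∀ n → IsEnumeration (permutationSetoid n) (permutations n)
permutations-complete zero    π = here λ ()
permutations-complete (suc n) π =
  ∈ₛ.∈-resp-≈ (permutationSetoid (suc n)) {x = insert zero (π ⟨$⟩ʳ zero) (remove zero π)} {π}
    (insert-remove zero π)
    (∈ₛ.∈-cartesianProductWith⁺ (setoid _) (permutationSetoid n) (permutationSetoid (suc n))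
      (λ {a} {b} {π} {ρ} → insert-cong {a = a} {b} {π} {ρ})
      (∈.∈-allFin (π ⟨$⟩ʳ zero)) (permutations-complete n (remove zero π)))

permutations-unique : ∀ n → Unique (permutationSetoid n) (permutations n)
permutations-unique zero    = All.[] AllPairs.∷ AllPairs.[]
permutations-unique (suc n) =
  Uniqueₛ.cartesianProductWith⁺ (setoid _) (permutationSetoid n) (permutationSetoid (suc n))
    (insert zero) (λ {a} {b} {π} {ρ} → insert-injective {a = a} {b} {π} {ρ})
    (Unique.allFin⁺ (suc n)) (permutations-unique n)

N₁₃₋₂ : ∀ {k} → Permutation′ k → ℕ → ℕ
N₁₃₋₂ p n = length (filter (λ π → avoids13-2? π ×-dec beginsWith? p π) (permutations n))

12⋯ : ∀ k → Permutation′ k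
12⋯ k = Perm.id

-- The division is exact: see catalan-exact.
catalan : ℕ → ℕ
catalan m = ((2 * m) C m) / suc m

nCk*k![n∸k]!≡n! : ∀ {n k} → k ≤ n → (n C k) * (k ! * (n ∸ k) !) ≡ n !
nCk*k![n∸k]!≡n! {n} {k} k≤n =
  trans (cong (_* (k ! * (n ∸ k) !)) (nCk≡n!/k![n-k]! k≤n)) (m/n*n≡m (k![n∸k]!∣n! k≤n))
  where instance _ = k !* (n ∸ k) !≢0

[1+k]*nC[1+k]≡[n∸k]*nCk : ∀ {n k} → k < n → suc k * (n C suc k) ≡ (n ∸ k) * (n C k)
[1+k]*nC[1+k]≡[n∸k]*nCk {n} {k} k<n = *-cancelʳ-≡ _ _ d (begin
  suc k * (n C suc k) * d                   ≡⟨ *-assoc (suc k) (n C suc k) d ⟩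
  suc k * ((n C suc k) * d)                 ≡⟨ cong (suc k *_) (nCk*k![n∸k]!≡n! k<n) ⟩
  suc k * n !                               ≡⟨ cong (suc k *_) (nCk*k![n∸k]!≡n! (<⇒≤ k<n)) ⟨
  suc k * ((n C k) * (k ! * (n ∸ k) !))     ≡⟨ x∙yz≈y∙xz (suc k) (n C k) _ ⟩
  (n C k) * (suc k * (k ! * (n ∸ k) !))     ≡⟨ cong ((n C k) *_) ([n-k]*d[k+1]≡[k+1]*d[k] k<n) ⟨
  (n C k) * ((n ∸ k) * d)                   ≡⟨ x∙yz≈yx∙z (n C k) (n ∸ k) d ⟩
  (n ∸ k) * (n C k) * d                     ∎)
  where
  open ≡-Reasoning
  open import Algebra.Properties.CommutativeSemigroup *-commutativeSemigroup
    using (x∙yz≈y∙xz; x∙yz≈yx∙z)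
  d = suc k ! * (n ∸ suc k) !
  instance _ = suc k !* (n ∸ suc k) !≢0

1+m∣2mCm : ∀ m → suc m ∣ (2 * m) C m
1+m∣2mCm zero      = divides 1 refl
1+m∣2mCm m@(suc _) = divides (B ∸ D) (sym (begin
  (B ∸ D) * suc m          ≡⟨ *-comm (B ∸ D) (suc m) ⟩
  suc m * (B ∸ D)          ≡⟨ *-distribˡ-∸ (suc m) B D ⟩
  suc m * B ∸ suc m * D    ≡⟨ cong (suc m * B ∸_) ([1+k]*nC[1+k]≡[n∸k]*nCk {2 * m} (m<m+n m z<s)) ⟩
  suc m * B ∸ (2 * m ∸ m) * B
    ≡⟨ cong (λ x → suc m * B ∸ x * B) (trans (m+n∸m≡n m (m + 0)) (+-identityʳ m)) ⟩
  suc m * B ∸ m * B        ≡⟨ m+n∸n≡m B (m * B) ⟩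
  B                        ∎))
  where
  open ≡-Reasoning
  B = (2 * m) C m
  D = (2 * m) C suc m

catalan-exact : ∀ m → catalan m * suc m ≡ (2 * m) C m
catalan-exact m = m/n*n≡m (1+m∣2mCm m)

{-# OPTIONS --safe #-}
-- Let a be put in front of a permutation π with first letter x. The result
-- avoids 13-2 iff π does and a is not below x: a smaller a would be followed by
-- the larger x + 1, with the letter a + 1 further right. Such an avoider begins
-- with an ascent exactly if a = x, the new letter pushing x up to x + 1.
-- Hence avoiders beginning with 12⋯(k+1) arise uniquely from avoiders beginning
-- with 12⋯k by doubling the first letter, which reduces everything to k = 1. There,
-- with s = n - x for letters counted from 0, the s + 1 avoiders above π have
-- labels 1, …, s + 1: this is the Catalan generating tree.
module Submission where

open import Defs
open import Data.Bool.Base using (if_then_else_; true; false)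
open import Data.Fin.Base as Fin using (Fin; zero; suc; toℕ; fromℕ<; inject≤; punchIn)
import Data.Fin.Properties as Fin
open import Data.Fin.Permutation as Perm
  using (Permutation′; _⟨$⟩ʳ_; _⟨$⟩ˡ_; insert; inverseʳ)
open import Data.List.Base using (List; []; _∷_; _++_; map; allFin; cartesianProductWith; filter; length)
open import Data.List.Properties using (map-++; map-∘; map-cong; map-tabulate)
open import Data.Nat.Base
open import Data.Nat.Combinatorics
open import Data.Nat.ListAction using (sum)
open import Data.Nat.ListAction.Properties using (sum-++)
open import Data.Nat.Properties
open import Data.Nat.Tactic.RingSolver using (solve-∀)
open import Data.Product.Base using (∃; _×_; _,_; proj₁)
open import Data.Vec.Functional as Vector using (Vector)
open import Function.Base using (_∘_; id)
open import Function.Bundles using (_⇔_; mk⇔; Equivalence)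
open import Relation.Binary.PropositionalEquality
open import Relation.Nullary using (Dec; does; yes; no; ¬_; contradiction)
open import Relation.Nullary.Decidable using (_×-dec_; does-⇔)
open import Relation.Unary using (Pred; Decidable)

open ≡-Reasoning

-- Finite sums and indicators

∑ : ∀ {A : Set} → List A → (A → ℕ) → ℕ
∑ xs f = sum (map f xs)

∑-cong : ∀ {A : Set} (xs : List A) {f g : A → ℕ} → (∀ x → f x ≡ g x) → ∑ xs f ≡ ∑ xs g
∑-cong xs f≗g = cong sum (map-cong f≗g xs)

∑-zero : ∀ {A : Set} (xs : List A) → ∑ xs (λ _ → 0) ≡ 0
∑-zero []       = refl
∑-zero (_ ∷ xs) = ∑-zero xs

∑-+ : ∀ {A : Set} (xs : List A) (f g : A → ℕ) → ∑ xs f + ∑ xs g ≡ ∑ xs (λ x → f x + g x)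
∑-+ []       f g = refl
∑-+ (x ∷ xs) f g = trans (interchange (f x) (∑ xs f) (g x) (∑ xs g)) (cong (f x + g x +_) (∑-+ xs f g))
  where
  interchange : ∀ a b c d → (a + b) + (c + d) ≡ (a + c) + (b + d)
  interchange = solve-∀

∑-*ˡ : ∀ {A : Set} (xs : List A) c (f : A → ℕ) → ∑ xs (λ x → c * f x) ≡ c * ∑ xs f
∑-*ˡ []       c f = sym (*-zeroʳ c)
∑-*ˡ (x ∷ xs) c f = trans (cong (c * f x +_) (∑-*ˡ xs c f)) (sym (*-distribˡ-+ c (f x) (∑ xs f)))

∑-allFin : ∀ n (f : Fin (suc n) → ℕ) → ∑ (allFin (suc n)) f ≡ f zero + ∑ (allFin n) (f ∘ suc)
∑-allFin n f = cong (λ ys → f zero + sum ys)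
  (trans (map-tabulate suc f) (sym (map-tabulate id (f ∘ suc))))

-- The sum over `ys` is put outermost so that, for permutations, the inner sum runs over the letters
-- put in front of one fixed tail.
∑-cartesianProductWith : ∀ {A B C : Set} (f : A → B → C) xs ys (g : C → ℕ) →
  ∑ (cartesianProductWith f xs ys) g ≡ ∑ ys (λ y → ∑ xs (λ x → g (f x y)))
∑-cartesianProductWith f []       ys g = sym (∑-zero ys)
∑-cartesianProductWith f (x ∷ xs) ys g = begin
  sum (map g (map (f x) ys ++ rest))           ≡⟨ cong sum (map-++ g (map (f x) ys) rest) ⟩
  sum (map g (map (f x) ys) ++ map g rest)     ≡⟨ sum-++ (map g (map (f x) ys)) (map g rest) ⟩
  sum (map g (map (f x) ys)) + ∑ rest g
    ≡⟨ cong₂ _+_ (cong sum (sym (map-∘ ys))) (∑-cartesianProductWith f xs ys g) ⟩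
  ∑ ys (λ y → g (f x y)) + ∑ ys (λ y → ∑ xs (λ x → g (f x y)))
    ≡⟨ ∑-+ ys _ _ ⟩
  ∑ ys (λ y → ∑ (x ∷ xs) (λ x → g (f x y)))    ∎
  where rest = cartesianProductWith f xs ys

∑-permutations : ∀ n (g : Permutation′ (suc n) → ℕ) →
  ∑ (permutations (suc n)) g ≡
  ∑ (permutations n) (λ π → ∑ (allFin (suc n)) (λ a → g (insert zero a π)))
∑-permutations n = ∑-cartesianProductWith (insert zero) (allFin (suc n)) (permutations n)

𝟙 : ∀ {A : Set} → Dec A → ℕ
𝟙 a? = if does a? then 1 else 0

𝟙-⇔ : ∀ {A B : Set} → A ⇔ B → (a? : Dec A) (b? : Dec B) → 𝟙 a? ≡ 𝟙 b?
𝟙-⇔ A⇔B a? b? = cong (if_then 1 else 0) (does-⇔ A⇔B a? b?)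

𝟙-× : ∀ {A B : Set} (a? : Dec A) (b? : Dec B) → 𝟙 (a? ×-dec b?) ≡ 𝟙 a? * 𝟙 b?
𝟙-× a? b? with does a? | does b?
... | true  | true  = refl
... | true  | false = refl
... | false | _     = refl

length-filter : ∀ {A : Set} {P : Pred A _} (P? : Decidable P) xs →
                length (filter P? xs) ≡ ∑ xs (𝟙 ∘ P?)
length-filter P? []       = refl
length-filter P? (x ∷ xs) with does (P? x)
... | true  = cong suc (length-filter P? xs)
... | false = length-filter P? xs

-- `h 0` is left out because the labels of children start at 1.
∑↓ : (ℕ → ℕ) → ℕ → ℕ
∑↓ h zero    = 0
∑↓ h (suc m) = h (suc m) + ∑↓ h m

-- Passing from a letter to its label, a ↦ n - a, turns the letters x, ..., n - 1 into the labels n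
-- - x, ..., 1.
∑-allFin-≥ : ∀ n x (h : ℕ → ℕ) →
  ∑ (allFin n) (λ a → 𝟙 (x ≤? toℕ a) * h (n ∸ toℕ a)) ≡ ∑↓ h (n ∸ x)
∑-allFin-≥ zero    zero    h = refl
∑-allFin-≥ zero    (suc x) h = refl
∑-allFin-≥ (suc n) zero    h = trans
  (∑-allFin n (λ a → 𝟙 (0 ≤? toℕ a) * h (suc n ∸ toℕ a)))
  (cong₂ _+_ (*-identityˡ (h (suc n))) (∑-allFin-≥ n 0 h))
∑-allFin-≥ (suc n) (suc x) h = begin
  ∑ (allFin (suc n)) (λ a → 𝟙 (suc x ≤? toℕ a) * h (suc n ∸ toℕ a))
    ≡⟨ ∑-allFin n (λ a → 𝟙 (suc x ≤? toℕ a) * h (suc n ∸ toℕ a)) ⟩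
  -- The term of the letter 0 has vanished by computation.
  ∑ (allFin n) (λ a → 𝟙 (suc x ≤? suc (toℕ a)) * h (n ∸ toℕ a))
    ≡⟨ ∑-cong (allFin n) (λ a → cong (_* h (n ∸ toℕ a))
         (𝟙-⇔ (mk⇔ s≤s⁻¹ s≤s) (suc x ≤? suc (toℕ a)) (x ≤? toℕ a))) ⟩
  ∑ (allFin n) (λ a → 𝟙 (x ≤? toℕ a) * h (n ∸ toℕ a))
    ≡⟨ ∑-allFin-≥ n x h ⟩
  ∑↓ h (n ∸ x) ∎

∑-allFin-≟ : ∀ n x → x < n → ∑ (allFin n) (λ a → 𝟙 (toℕ a ≟ x)) ≡ 1
∑-allFin-≟ (suc n) zero    _     = trans
  (∑-allFin n (λ a → 𝟙 (toℕ a ≟ 0))) (cong suc (∑-zero (allFin n)))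
∑-allFin-≟ (suc n) (suc x) x<n = begin
  ∑ (allFin (suc n)) (λ a → 𝟙 (toℕ a ≟ suc x))
    ≡⟨ ∑-allFin n (λ a → 𝟙 (toℕ a ≟ suc x)) ⟩
  ∑ (allFin n) (λ a → 𝟙 (suc (toℕ a) ≟ suc x))
    ≡⟨ ∑-cong (allFin n) (λ a →
         𝟙-⇔ (mk⇔ suc-injective (cong suc)) (suc (toℕ a) ≟ suc x) (toℕ a ≟ x)) ⟩
  ∑ (allFin n) (λ a → 𝟙 (toℕ a ≟ x))
    ≡⟨ ∑-allFin-≟ n x (s≤s⁻¹ x<n) ⟩
  1 ∎

-- Ballot and Catalan numbers

-- The number of descendants, d generations below, of a node labelled s in the
-- tree where a node labelled s has children labelled 1, …, s + 1.
ballot : ℕ → ℕ → ℕ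
ballot zero    s       = 1
ballot (suc d) zero    = ballot d 1
ballot (suc d) (suc s) = ballot (suc d) s + ballot d (2 + s)

-- Unrolling the recursion of `ballot` in its second argument gives one summand for each of the
-- children 1, ..., s + 1.
ballot-suc : ∀ d s → ∑↓ (ballot d) (suc s) ≡ ballot (suc d) s
ballot-suc d zero    = +-identityʳ (ballot d 1)
ballot-suc d (suc s) = trans (+-comm (ballot d (2 + s)) _) (cong (_+ ballot d (2 + s)) (ballot-suc d s))

nC0≡1 : ∀ n → n C 0 ≡ 1
nC0≡1 n = trans (nCk≡nC[n∸k] {0} {n} z≤n) (nCn≡1 n)

-- C(n, k - 1), with the value 0 at k = 0.
_C⁻_ : ℕ → ℕ → ℕ
n C⁻ zero  = 0
n C⁻ suc k = n C k

pascal⁻ : ∀ n k → n C⁻ k + n C k ≡ suc n C k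
-- The default 0 makes Pascal's rule hold in column 0 as 0 + 1 = 1.
pascal⁻ n zero    = trans (nC0≡1 n) (sym (nC0≡1 (suc n)))
pascal⁻ n (suc k) = nCk+nC[k+1]≡[n+1]C[k+1] n k

-- Reflection principle, with the subtracted term moved to the left.
ballot-closed : ∀ d s → ballot d s + (d + (d + s)) C⁻ d ≡ (d + (d + s)) C d
ballot-closed zero    s    = sym (nC0≡1 s)
ballot-closed (suc d) zero = begin
  ballot d 1 + suc N C d               ≡⟨ cong (ballot d 1 +_) (pascal⁻ N d) ⟨
  ballot d 1 + (N C⁻ d + N C d)        ≡⟨ +-assoc (ballot d 1) _ _ ⟨
  ballot d 1 + N C⁻ d + N C d          ≡⟨ cong (_+ N C d) (subst (λ m → ballot d 1 + m C⁻ d ≡ m C d)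
                                                     (cong (d +_) (+-suc d 0)) (ballot-closed d 1)) ⟩
  N C d + N C d                        ≡⟨ cong (N C d +_) mid ⟩
  N C d + N C suc d                    ≡⟨ nCk+nC[k+1]≡[n+1]C[k+1] N d ⟩
  suc N C suc d                        ∎
  where
  N = d + suc (d + 0)
  -- `N` = 2d + 1 is odd, so the two middle entries of its row agree by symmetry.
  mid : N C d ≡ N C suc d
  mid = trans (nCk≡nC[n∸k] {d} {N} (m≤m+n d _))
    (cong (N C_) (trans (m+n∸m≡n d _) (cong suc (+-identityʳ d))))
ballot-closed (suc d) (suc s) = begin
  ballot (suc d) s + B + suc N C d               ≡⟨ cong (ballot (suc d) s + B +_) (pascal⁻ N d) ⟨
  ballot (suc d) s + B + (N C⁻ d + N C d)        ≡⟨ rearrange (ballot (suc d) s) B (N C⁻ d) (N C d) ⟩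
  -- Both induction hypotheses, at (d, s + 2) and (d + 1, s), live in the same row `N` = 2d + s + 2.
  (B + N C⁻ d) + (ballot (suc d) s + N C d)      ≡⟨ cong₂ _+_
      (subst (λ m → B + m C⁻ d ≡ m C d) (cong (d +_) (+-suc d (suc s))) (ballot-closed d (2 + s)))
      (subst (λ m → ballot (suc d) s + m C⁻ suc d ≡ m C suc d)
        (trans (sym (+-suc d (suc (d + s)))) (cong (λ m → d + suc m) (sym (+-suc d s))))
        (ballot-closed (suc d) s)) ⟩
  N C d + N C suc d                              ≡⟨ nCk+nC[k+1]≡[n+1]C[k+1] N d ⟩
  suc N C suc d                                  ∎
  where
  N = d + suc (d + suc s)
  B = ballot d (2 + s)
  rearrange : ∀ a b c d → a + b + (c + d) ≡ (b + c) + (a + d)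
  rearrange = solve-∀

-- `ballot n 1` unfolds from `ballot m 0`, where reflection gives W + D = B. Multiplied by m + 1,
-- with (m + 1)D = mB, this leaves (m + 1)W = B.
ballot≡catalan : ∀ n → ballot n 1 ≡ catalan (suc n)
ballot≡catalan n = *-cancelʳ-≡ _ _ (suc m) (trans (+-cancelʳ-≡ (m * B) _ _ (begin
  W * suc m + m * B           ≡⟨ cong₂ _+_ (*-comm W (suc m)) (sym absorb) ⟩
  suc m * W + suc m * D       ≡⟨ *-distribˡ-+ (suc m) W D ⟨
  suc m * (W + D)             ≡⟨ cong (suc m *_) (ballot-closed m 0) ⟩
  B + m * B                   ∎)) (sym (catalan-exact m)))
  where
  m = suc n
  W = ballot m 0
  B = (2 * m) C m
  D = (2 * m) C n
  absorb : suc m * D ≡ m * B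
  absorb = begin
    suc m * D              ≡⟨ cong (_* D) 2m∸n ⟨
    (2 * m ∸ n) * D        ≡⟨ [1+k]*nC[1+k]≡[n∸k]*nCk {2 * m} {n} (s≤s (m≤m+n n _)) ⟨
    m * B                  ∎
    where
    2m∸n : 2 * m ∸ n ≡ suc m
    2m∸n = trans (cong (_∸ n) (sum′ n)) (m+n∸m≡n n (suc m))
      where
      sum′ : ∀ n → 2 * suc n ≡ n + suc (suc n)
      sum′ = solve-∀

-- Order and `punchIn`

punchIn-≤ : ∀ {n} (a : Fin (suc n)) (b : Fin n) → toℕ a ≤ toℕ b → toℕ (punchIn a b) ≡ suc (toℕ b)
punchIn-≤ zero    b       _         = refl
punchIn-≤ (suc a) (suc b) (s≤s a≤b) = cong suc (punchIn-≤ a b a≤b)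

punchIn-> : ∀ {n} (a : Fin (suc n)) (b : Fin n) → toℕ b < toℕ a → toℕ (punchIn a b) ≡ toℕ b
punchIn-> (suc a) zero    _         = refl
punchIn-> (suc a) (suc b) (s≤s b<a) = cong suc (punchIn-> a b b<a)

-- The inequality on the right is weak because a letter equal to `a` is itself pushed up to `a` + 1.
punchIn-<⇔ : ∀ {n} (a : Fin (suc n)) (b : Fin n) → a Fin.< punchIn a b ⇔ a Fin.≤ b
punchIn-<⇔ a b = mk⇔ to (λ a≤b → subst (toℕ a <_) (sym (punchIn-≤ a b a≤b)) (s≤s a≤b))
  where
  to : a Fin.< punchIn a b → a Fin.≤ b
  to a<p with toℕ a ≤? toℕ b
  ... | yes a≤b = a≤b
  ... | no  a≰b = contradiction (subst (toℕ a <_) (punchIn-> a b (≰⇒> a≰b)) a<p) (<-asym (≰⇒> a≰b))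

punchIn-mono-< : ∀ {n} (a : Fin (suc n)) (b c : Fin n) → b Fin.< c → punchIn a b Fin.< punchIn a c
punchIn-mono-< a b c b<c = ≰⇒> (<⇒≱ b<c ∘ Fin.punchIn-cancel-≤ a c b)

punchIn-cancel-< : ∀ {n} (a : Fin (suc n)) (b c : Fin n) → punchIn a b Fin.< punchIn a c → b Fin.< c
punchIn-cancel-< a b c p<q = ≰⇒> (<⇒≱ p<q ∘ Fin.punchIn-mono-≤ a c b)

-- Occurrences of 13-2

-- The chain first < third < second settles all nine comparisons, by transitivity, asymmetry and
-- irreflexivity.
orderIsomorphic-132 : ∀ (u : Vector ℕ 3) →
  OrderIsomorphic u (1 Vector.∷ 3 Vector.∷ 2 Vector.∷ Vector.[]) ⇔ (u zero < u (suc (suc zero)) × u (suc (suc zero)) < u (suc zero))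
orderIsomorphic-132 u = mk⇔
  (λ iso → Equivalence.from (iso zero (suc (suc zero))) (s≤s (s≤s z≤n))
         , Equivalence.from (iso (suc (suc zero)) (suc zero)) (s≤s (s≤s (s≤s z≤n))))
  λ { (x<z , z<y) → from x<z z<y }
  where
  both : ∀ {A B : Set} → A → B → A ⇔ B
  both a b = mk⇔ (λ _ → b) (λ _ → a)
  neither : ∀ {A B : Set} → ¬ A → ¬ B → A ⇔ B
  neither ¬a ¬b = mk⇔ (λ a → contradiction a ¬a) (λ b → contradiction b ¬b)
  from : u zero < u (suc (suc zero)) → u (suc (suc zero)) < u (suc zero) →
         OrderIsomorphic u (1 Vector.∷ 3 Vector.∷ 2 Vector.∷ Vector.[])
  from x<z z<y zero             zero             = neither (<-irrefl refl) (<-irrefl refl)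
  from x<z z<y zero             (suc zero)       = both (<-trans x<z z<y) (s≤s (s≤s z≤n))
  from x<z z<y zero             (suc (suc zero)) = both x<z (s≤s (s≤s z≤n))
  from x<z z<y (suc zero)       zero             = neither (<-asym (<-trans x<z z<y)) (λ { (s≤s ()) })
  from x<z z<y (suc zero)       (suc zero)       = neither (<-irrefl refl) (<-irrefl refl)
  from x<z z<y (suc zero)       (suc (suc zero)) = neither (<-asym z<y) (λ { (s≤s (s≤s ())) })
  from x<z z<y (suc (suc zero)) zero             = neither (<-asym x<z) (λ { (s≤s ()) })
  from x<z z<y (suc (suc zero)) (suc zero)       = both z<y (s≤s (s≤s (s≤s z≤n)))
  from x<z z<y (suc (suc zero)) (suc (suc zero)) = neither (<-irrefl refl) (<-irrefl refl)

-- Letters are compared from 0, without the `suc` of `word`, to fit `punchIn`.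
Occurrence : ∀ {n} → Permutation′ n → Fin n → Fin n → Fin n → Set
Occurrence π i i⁺ j = toℕ i⁺ ≡ suc (toℕ i) × i⁺ Fin.< j ×
  (π ⟨$⟩ʳ i) Fin.< (π ⟨$⟩ʳ j) × (π ⟨$⟩ʳ j) Fin.< (π ⟨$⟩ʳ i⁺)

contains : ∀ {n} (π : Permutation′ n) {i i⁺ j} → Occurrence π i i⁺ j → Contains13-2 π
contains π (eq , i⁺<j , x<z , z<y) =
  _ , _ , _ , eq , i⁺<j , Equivalence.from (orderIsomorphic-132 _) (s≤s x<z , s≤s z<y)

occurrence : ∀ {n} (π : Permutation′ n) →
             Contains13-2 π → ∃ λ i → ∃ λ i⁺ → ∃ λ j → Occurrence π i i⁺ j
occurrence π (i , i⁺ , j , eq , i⁺<j , iso) with Equivalence.to (orderIsomorphic-132 _) iso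
... | x<z , z<y = i , i⁺ , j , eq , i⁺<j , s≤s⁻¹ x<z , s≤s⁻¹ z<y

-- Putting a letter in front

module _ {n} (a : Fin (2 + n)) (π : Permutation′ (suc n)) where

  private
    π⁺ = insert zero a π
    x  = π ⟨$⟩ʳ zero

  avoids-tail : Avoids13-2 π⁺ → Avoids13-2 π
  avoids-tail av c with occurrence π c
  ... | i , i⁺ , j , eq , i⁺<j , x<z , z<y = av (contains π⁺ {suc i} {suc i⁺} {suc j}
    (cong suc eq , s≤s i⁺<j , punchIn-mono-< a _ _ x<z , punchIn-mono-< a _ _ z<y))

  avoids-head : Avoids13-2 π⁺ → x Fin.≤ a
  avoids-head av with toℕ x ≤? toℕ a
  ... | yes x≤a = x≤a
  ... | no  x≰a = contradiction (contains π⁺ {zero} {suc zero} {suc j}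
          (refl , s≤s 0<j , lo , punchIn-mono-< a _ _ b<x)) av
    where
    a<x : toℕ a < toℕ x
    a<x = ≰⇒> x≰a
    a<n : toℕ a < suc n
    a<n = <-trans a<x (Fin.toℕ<n x)
    -- The letter `a` of `π`: insertion raises it to `a` + 1, the 2 of an occurrence whose 1 and 3
    -- are `a` and the raised `x`.
    b = fromℕ< a<n
    j = π ⟨$⟩ˡ b
    πj : π ⟨$⟩ʳ j ≡ b
    πj = inverseʳ π
    toℕ-πj : toℕ (π ⟨$⟩ʳ j) ≡ toℕ a
    toℕ-πj = trans (cong toℕ πj) (Fin.toℕ-fromℕ< a<n)
    b<x : (π ⟨$⟩ʳ j) Fin.< x
    b<x = subst (_< toℕ x) (sym toℕ-πj) a<x
    lo : a Fin.< punchIn a (π ⟨$⟩ʳ j)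
    lo = Equivalence.from (punchIn-<⇔ a (π ⟨$⟩ʳ j)) (≤-reflexive (sym toℕ-πj))
    0<j : 0 < toℕ j
    -- The letter at `j` is below `x`, so `j` is not the first position.
    0<j = n≢0⇒n>0 λ j≡0 → <-irrefl (cong (λ i → toℕ (π ⟨$⟩ʳ i)) (Fin.toℕ-injective j≡0)) b<x

  avoids-insert : Avoids13-2 π → x Fin.≤ a → Avoids13-2 π⁺
  avoids-insert av x≤a c with occurrence π⁺ c
  -- An occurrence using the new letter has it as its 1; its 2 would come from a letter z of `π`
  -- with a ≤ z < x, against x ≤ a.
  ... | zero  , suc zero , suc j , eq , _ , a<z , z<y = <-irrefl refl (<-≤-trans
          (punchIn-cancel-< a _ _ z<y) (≤-trans x≤a (Equivalence.to (punchIn-<⇔ a _) a<z)))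
  -- All other occurrences lie within `π`.
  ... | suc i , suc i⁺ , suc j , eq , s≤s i⁺<j , x<z , z<y = av (contains π
          (suc-injective eq , i⁺<j , punchIn-cancel-< a _ _ x<z , punchIn-cancel-< a _ _ z<y))

  avoids-insert⇔ : Avoids13-2 π⁺ ⇔ (Avoids13-2 π × x Fin.≤ a)
  avoids-insert⇔ = mk⇔ (λ av → avoids-tail av , avoids-head av) λ { (av , x≤a) → avoids-insert av x≤a }

  begins-tail : ∀ k → BeginsWith (12⋯ (2 + k)) π⁺ → BeginsWith (12⋯ (suc k)) π
  begins-tail k (s≤s k≤n , iso) = k≤n , λ i j → mk⇔
    (λ { (s≤s p) → s≤s⁻¹ (Equivalence.to (iso (suc i) (suc j)) (s≤s (punchIn-mono-< a _ _ p))) })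
    (λ q → s≤s (punchIn-cancel-< a _ _ (s≤s⁻¹ (Equivalence.from (iso (suc i) (suc j)) (s≤s q)))))

  begins-head : ∀ k → BeginsWith (12⋯ (2 + k)) π⁺ → a Fin.≤ x
  begins-head k (s≤s (s≤s k≤n) , iso) =
    Equivalence.to (punchIn-<⇔ a x) (s≤s⁻¹ (Equivalence.from (iso zero (suc zero)) (s≤s (s≤s z≤n))))

  -- `x` is the least letter of the increasing prefix, so `a ≤ x` puts the new letter strictly below
  -- the whole raised prefix.
  begins-insert : ∀ k → BeginsWith (12⋯ (suc k)) π → a Fin.≤ x → BeginsWith (12⋯ (2 + k)) π⁺
  begins-insert k (s≤s k≤n , iso) a≤x = s≤s (s≤s k≤n) , iso′
    where
    x≤ : ∀ j → x Fin.≤ (π ⟨$⟩ʳ inject≤ j (s≤s k≤n))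
    x≤ zero    = ≤-refl
    x≤ (suc j) = <⇒≤ (s≤s⁻¹ (Equivalence.from (iso zero (suc j)) (s≤s (s≤s z≤n))))
    a< : ∀ j → a Fin.< punchIn a (π ⟨$⟩ʳ inject≤ j (s≤s k≤n))
    a< j = Equivalence.from (punchIn-<⇔ a _) (≤-trans a≤x (x≤ j))
    iso′ : OrderIsomorphic (λ i → word π⁺ (inject≤ i (s≤s (s≤s k≤n)))) (word (12⋯ (2 + k)))
    iso′ zero    zero    = mk⇔ (λ p → contradiction p (<-irrefl refl)) (λ p → contradiction p (<-irrefl refl))
    iso′ zero    (suc j) = mk⇔ (λ _ → s≤s (s≤s z≤n)) (λ _ → s≤s (a< j))
    iso′ (suc i) zero    = mk⇔ (λ p → contradiction (s≤s (a< i)) (<-asym p)) (λ { (s≤s ()) })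
    iso′ (suc i) (suc j) = mk⇔
      (λ { (s≤s p) → s≤s (Equivalence.to (iso i j) (s≤s (punchIn-cancel-< a _ _ p))) })
      (λ { (s≤s q) → s≤s (punchIn-mono-< a _ _ (s≤s⁻¹ (Equivalence.from (iso i j) q))) })

  -- Avoidance forces x ≤ a and the initial ascent forces a ≤ x.
  avoids-begins-insert⇔ : ∀ k →
    (Avoids13-2 π⁺ × BeginsWith (12⋯ (2 + k)) π⁺) ⇔
    ((Avoids13-2 π × BeginsWith (12⋯ (suc k)) π) × toℕ a ≡ toℕ x)
  avoids-begins-insert⇔ k = mk⇔
    (λ { (av , bg) → (avoids-tail av , begins-tail k bg)
                   , ≤-antisym (begins-head k bg) (avoids-head av) })
    (λ { ((av , bg) , a≡x) → avoids-insert av (≤-reflexive (sym a≡x))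
                           , begins-insert k bg (≤-reflexive a≡x) })

begins-1 : ∀ {n} (π : Permutation′ (suc n)) → BeginsWith (12⋯ 1) π
begins-1 π = s≤s z≤n , λ { zero zero →
  mk⇔ (λ p → contradiction p (<-irrefl refl)) (λ p → contradiction p (<-irrefl refl)) }

-- Counting the avoiders

avoids-begins? : ∀ k {n} (π : Permutation′ n) → Dec (Avoids13-2 π × BeginsWith (12⋯ k) π)
avoids-begins? k π = avoids13-2? π ×-dec beginsWith? (12⋯ k) π

N-suc : ∀ k n → N₁₃₋₂ (12⋯ (2 + k)) (2 + n) ≡ N₁₃₋₂ (12⋯ (suc k)) (suc n)
N-suc k n = begin
  N₁₃₋₂ (12⋯ (2 + k)) (2 + n)
    ≡⟨ length-filter (avoids-begins? (2 + k)) (permutations (2 + n)) ⟩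
  ∑ (permutations (2 + n)) (𝟙 ∘ avoids-begins? (2 + k))
    ≡⟨ ∑-permutations (suc n) (𝟙 ∘ avoids-begins? (2 + k)) ⟩
  ∑ (permutations (suc n)) (λ π → ∑ (allFin (2 + n)) λ a → 𝟙 (avoids-begins? (2 + k) (insert zero a π)))
    ≡⟨ ∑-cong (permutations (suc n)) inner ⟩
  ∑ (permutations (suc n)) (𝟙 ∘ avoids-begins? (suc k))
    ≡⟨ length-filter (avoids-begins? (suc k)) (permutations (suc n)) ⟨
  N₁₃₋₂ (12⋯ (suc k)) (suc n) ∎
  where
  inner : ∀ π → ∑ (allFin (2 + n)) (λ a → 𝟙 (avoids-begins? (2 + k) (insert zero a π))) ≡
                𝟙 (avoids-begins? (suc k) π)
  inner π = begin
    ∑ (allFin (2 + n)) (λ a → 𝟙 (avoids-begins? (2 + k) (insert zero a π)))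
      ≡⟨ ∑-cong (allFin (2 + n)) (λ a → trans
           (𝟙-⇔ (avoids-begins-insert⇔ a π k) (avoids-begins? (2 + k) (insert zero a π))
                 (avoids-begins? (suc k) π ×-dec toℕ a ≟ toℕ x))
           (𝟙-× (avoids-begins? (suc k) π) (toℕ a ≟ toℕ x))) ⟩
    ∑ (allFin (2 + n)) (λ a → c * 𝟙 (toℕ a ≟ toℕ x))
      ≡⟨ ∑-*ˡ (allFin (2 + n)) c (λ a → 𝟙 (toℕ a ≟ toℕ x)) ⟩
    c * ∑ (allFin (2 + n)) (λ a → 𝟙 (toℕ a ≟ toℕ x))
      -- Exactly one new letter equals `x`, so each `π` has exactly one candidate extension.
      ≡⟨ cong (c *_) (∑-allFin-≟ (2 + n) (toℕ x) (m≤n⇒m≤1+n (Fin.toℕ<n x))) ⟩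
    c * 1
      ≡⟨ *-identityʳ c ⟩
    c ∎
    where
    x = π ⟨$⟩ʳ zero
    c = 𝟙 (avoids-begins? (suc k) π)

-- An avoider has label `suc n` minus its first letter; the weight counts its descendants `d`
-- generations below.
weight : ∀ {n} → ℕ → Permutation′ (suc n) → ℕ
weight {n} d π = 𝟙 (avoids13-2? π) * ballot d (suc n ∸ toℕ (π ⟨$⟩ʳ zero))

-- Each step trades one generation of listed permutations for one of depth, keeping `n + d`. What
-- remains is the root, the one-letter permutation with label 1.
∑-weight : ∀ n d → ∑ (permutations (suc n)) (weight d) ≡ ballot (n + d) 1
∑-weight zero    d = trans (+-identityʳ (weight d σ))
  (trans (cong (_* ballot d 1) (𝟙-⇔ {B = Avoids13-2 σ} (mk⇔ id id) (avoids13-2? σ) (yes avoids-σ)))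
         (*-identityˡ (ballot d 1)))
  where
  σ : Permutation′ 1
  σ = insert zero zero Perm.id
  avoids-σ : Avoids13-2 σ
  avoids-σ (zero , zero , _ , () , _)
  avoids-σ (zero , suc () , _)
∑-weight (suc n) d = begin
  ∑ (permutations (2 + n)) (weight d)
    ≡⟨ ∑-permutations (suc n) (weight d) ⟩
  ∑ (permutations (suc n)) (λ π → ∑ (allFin (2 + n)) (λ a → weight d (insert zero a π)))
    ≡⟨ ∑-cong (permutations (suc n)) inner ⟩
  ∑ (permutations (suc n)) (weight (suc d))
    ≡⟨ ∑-weight n (suc d) ⟩
  ballot (n + suc d) 1
    ≡⟨ cong (λ m → ballot m 1) (+-suc n d) ⟩
  ballot (suc n + d) 1 ∎
  where
  inner : ∀ π → ∑ (allFin (2 + n)) (λ a → weight d (insert zero a π)) ≡ weight (suc d) π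
  inner π = begin
    ∑ (allFin (2 + n)) (λ a → 𝟙 (avoids13-2? (insert zero a π)) * ballot d (2 + n ∸ toℕ a))
      ≡⟨ ∑-cong (allFin (2 + n)) (λ a → trans
           (cong (_* ballot d (2 + n ∸ toℕ a)) (trans
             (𝟙-⇔ (avoids-insert⇔ a π) (avoids13-2? (insert zero a π)) (avoids13-2? π ×-dec x ≤? toℕ a))
             (𝟙-× (avoids13-2? π) (x ≤? toℕ a))))
           (*-assoc c (𝟙 (x ≤? toℕ a)) _)) ⟩
    ∑ (allFin (2 + n)) (λ a → c * (𝟙 (x ≤? toℕ a) * ballot d (2 + n ∸ toℕ a)))
      ≡⟨ ∑-*ˡ (allFin (2 + n)) c _ ⟩
    c * ∑ (allFin (2 + n)) (λ a → 𝟙 (x ≤? toℕ a) * ballot d (2 + n ∸ toℕ a))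
      ≡⟨ cong (c *_) (∑-allFin-≥ (2 + n) x (ballot d)) ⟩
    c * ∑↓ (ballot d) (2 + n ∸ x)
      -- With s = `suc n ∸ x` the label of `π`, the children have labels up to s + 1; `x ≤ suc n`
      -- rules out truncation.
      ≡⟨ cong (λ s → c * ∑↓ (ballot d) s) (+-∸-assoc 1 (<⇒≤ (Fin.toℕ<n (π ⟨$⟩ʳ zero)))) ⟩
    c * ∑↓ (ballot d) (suc (suc n ∸ x))
      ≡⟨ cong (c *_) (ballot-suc d (suc n ∸ x)) ⟩
    c * ballot (suc d) (suc n ∸ x) ∎
    where
    x = toℕ (π ⟨$⟩ʳ zero)
    c = 𝟙 (avoids13-2? π)

N-1 : ∀ n → N₁₃₋₂ (12⋯ 1) (suc n) ≡ catalan (suc n)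
N-1 n = begin
  N₁₃₋₂ (12⋯ 1) (suc n)
    ≡⟨ length-filter (avoids-begins? 1) (permutations (suc n)) ⟩
  ∑ (permutations (suc n)) (𝟙 ∘ avoids-begins? 1)
    ≡⟨ ∑-cong (permutations (suc n)) (λ π → trans
         (𝟙-⇔ (mk⇔ proj₁ (_, begins-1 π)) (avoids-begins? 1 π) (avoids13-2? π))
         (sym (*-identityʳ _))) ⟩
  ∑ (permutations (suc n)) (λ π → 𝟙 (avoids13-2? π) * 1)
    -- `ballot 0` is constantly 1, so these are the weights of depth 0.
    ≡⟨ ∑-weight n 0 ⟩
  ballot (n + 0) 1
    ≡⟨ cong (λ m → ballot m 1) (+-identityʳ n) ⟩
  ballot n 1
    ≡⟨ ballot≡catalan n ⟩
  catalan (suc n) ∎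

proposition13 : ∀ (k : ℕ) → 1 ≤ k → ∀ (n : ℕ) → k ≤ n → N₁₃₋₂ (12⋯ k) n ≡ catalan (n + 1 ∸ k)
proposition13 1             _   (suc n)       _         = trans (N-1 n) (cong catalan (+-comm 1 n))
-- Lowering `k` and `n` together keeps `n + 1 ∸ k` by computation.
proposition13 (suc (suc k)) 1≤k (suc (suc n)) (s≤s k≤n) =
  trans (N-suc k n) (proposition13 (suc k) (s≤s z≤n) (suc n) k≤n)
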